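{- Let $N\ge1$, let $\phi:H_0(S_N)\to M_N$ be the quotient morphism sending $\pi_i\mapsto\pi_i$, where $M_N$ is the quotient of $H_0(S_N)$ by the relations $\pi_i\pi_{i+1}\pi_i=\pi_i\pi_{i+1}$ ($1\le i\le N-2$), and let $\Psi$ be the automorphism of $H_0(S_N)$ with $\Psi(\pi_i)=\pi_{N-i}$. For every $m\in M_N$ let $G_m=\{w\in S_N: \phi(\Psi(\pi_w))=m\}$. Every nonempty $G_m$ contains a unique $[321]$-avoiding permutation, which is of minimal length in $G_m$, and a unique $[312]$-avoiding permutation, which is of maximal length in $G_m$.
   Context: $S_N$ is generated by simple transpositions $s_1,\dots,s_{N-1}$; permutations are in one-line notation and composed as functions, $(uv)(j)=u(v(j))$, so $xs_i$ swaps the entries in positions $i,i+1$. $\operatorname{len}$ is Coxeter length (number of inversions). $H_0(S_N)$ is generated by $\pi_1,\dots,\pi_{N-1}$ with relations $\pi_i^2=\pi_i$, $\pi_i\pi_j=\pi_j\pi_i$ for $|i-j|\ge2$, $\pi_i\pi_{i+1}\pi_i=\pi_{i+1}\pi_i\pi_{i+1}$; $\pi_w:=\pi_{i_1}\cdots\pi_{i_k}$ for any reduced word $w=s_{i_1}\cdots s_{i_k}$, giving a bijection $S_N\to H_0(S_N)$. A permutation contains a pattern $\sigma\in S_k$ if some subsequence of its one-line notation is in the same relative order as $\sigma$; otherwise it avoids $\sigma$. -}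

module Defs where

open import Algebra.Bundles using (Monoid)
open import Algebra.Morphism.Structures using (module MonoidMorphisms)
open import Data.Fin.Base using (Fin; suc; toℕ; inject₁; opposite; _<_)
open import Data.Fin.Patterns using (0F; 1F; 2F)
open import Data.Fin.Permutation as Perm
  using (Permutation′; permutation; transpose; _⟨$⟩ʳ_; _∘ₚ_)
open import Data.Fin.Properties using (_<?_; opposite-prop; opposite-involutive; toℕ<n)
open import Data.List.Base using
  (List; []; _∷_; _++_; map; length; filter; allFin; cartesianProduct)
open import Data.List.Properties using (++-assoc; ++-identityʳ; map-++; map-∘; map-cong; map-id)
open import Data.Nat.Base as ℕ using (ℕ; suc; ∣_-_∣)
import Data.Nat.Properties as ℕ
open import Data.Product.Base using (∃; _×_; _,_)
open import Data.Vec.Base as Vec using (Vec)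
open import Function.Bundles using (_⇔_)
open import Level using (0ℓ)
open import Relation.Binary.Core using (Rel)
open import Relation.Binary.PropositionalEquality as ≡
  using (_≡_; refl)
open import Relation.Nullary using (¬_; _×-dec_)
open import Relation.Unary using (Pred)

-- Presented monoids: words over A modulo the congruence generated by R.

module _ {A : Set} (R : Rel (List A) 0ℓ) where

  data Congruence : Rel (List A) 0ℓ where
    rel     : ∀ {u v} → R u v → Congruence u v
    refl    : ∀ {u} → Congruence u u
    sym     : ∀ {u v} → Congruence u v → Congruence v u
    trans   : ∀ {u v w} → Congruence u v → Congruence v w → Congruence u w
    ++-cong : ∀ {u u′ v v′} → Congruence u u′ → Congruence v v′ →
              Congruence (u ++ v) (u′ ++ v′)

  Presented : Monoid 0ℓ 0ℓ
  Presented = record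
    { Carrier  = List A
    ; _≈_      = Congruence
    ; _∙_      = _++_
    ; ε        = []
    ; isMonoid = record
      { isSemigroup = record
        { isMagma = record
          { isEquivalence = record { refl = refl ; sym = sym ; trans = trans }
          ; ∙-cong        = ++-cong
          }
        ; assoc = λ u v w → ≡⇒≈ (++-assoc u v w)
        }
      ; identity = (λ _ → refl) , (λ u → ≡⇒≈ (++-identityʳ u))
      }
    }
    where
    ≡⇒≈ : ∀ {u v} → u ≡ v → Congruence u v
    ≡⇒≈ refl = refl

-- Throughout N = suc n, and i : Fin n indexes the generators s_{i+1} and
-- π_{i+1}, so indices and one-line entries are shifted down by one.

Word : ℕ → Set
Word n = List (Fin n)

data HeckeRel {n : ℕ} : Rel (Word n) 0ℓ where
  idem  : ∀ i → HeckeRel (i ∷ i ∷ []) (i ∷ [])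
  comm  : ∀ i j → 2 ℕ.≤ ∣ toℕ i - toℕ j ∣ → HeckeRel (i ∷ j ∷ []) (j ∷ i ∷ [])
  braid : ∀ i j → toℕ j ≡ suc (toℕ i) →
          HeckeRel (i ∷ j ∷ i ∷ []) (j ∷ i ∷ j ∷ [])

data MRel {n : ℕ} : Rel (Word n) 0ℓ where
  hecke : ∀ {u v} → HeckeRel u v → MRel u v
  quot  : ∀ i j → toℕ j ≡ suc (toℕ i) → MRel (i ∷ j ∷ i ∷ []) (i ∷ j ∷ [])

-- H₀ n is H_0(S_{n+1}) and M n is M_{n+1}.

H₀ : ℕ → Monoid 0ℓ 0ℓ
H₀ n = Presented (HeckeRel {n})

M : ℕ → Monoid 0ℓ 0ℓ
M n = Presented (MRel {n})

module H₀ (n : ℕ) = Monoid (H₀ n)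
module M  (n : ℕ) = Monoid (M n)

φ : ∀ {n} → H₀.Carrier n → M.Carrier n
φ u = u

-- opposite sends i to n - 1 - i, i.e. π_{i+1} to π_{N-(i+1)}.

Ψ : ∀ {n} → H₀.Carrier n → H₀.Carrier n
Ψ = map opposite

s : ∀ {n} → Fin n → Permutation′ (suc n)
s i = transpose (inject₁ i) (suc i)

infixr 9 _·_

-- (u · v)(j) = u(v(j)); the library's _∘ₚ_ composes in the other order.

_·_ : ∀ {N} → Permutation′ N → Permutation′ N → Permutation′ N
u · v = v ∘ₚ u

⟦_⟧ : ∀ {n} → Word n → Permutation′ (suc n)
⟦ [] ⟧    = Perm.id
⟦ i ∷ u ⟧ = s i · ⟦ u ⟧

len : ∀ {N} → Permutation′ N → ℕ
len {N} w = length
  (filter (λ (i , j) → i <? j ×-dec (w ⟨$⟩ʳ j) <? (w ⟨$⟩ʳ i))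
          (cartesianProduct (allFin N) (allFin N)))

record IsReducedWordFor {n} (w : Permutation′ (suc n)) (u : Word n) : Set where
  field
    represents : ⟦ u ⟧ Perm.≈ w
    minimal    : ∀ v → ⟦ v ⟧ Perm.≈ w → length u ℕ.≤ length v

-- Read as a word in the πᵢ, a reduced word u for w is a representative of
-- π_w; by Matsumoto's theorem its class in H₀ n does not depend on u.

G : ∀ {n} → M.Carrier n → Pred (Permutation′ (suc n)) 0ℓ
G {n} m w = ∃ λ u → IsReducedWordFor w u × M._≈_ n (φ (Ψ u)) m

record Contains {k N} (σ : Permutation′ k) (w : Permutation′ N) : Set where
  field
    position   : Fin k → Fin N
    increasing : ∀ {a b} → a < b → position a < position b
    sameOrder  : ∀ a b → (w ⟨$⟩ʳ position a) < (w ⟨$⟩ʳ position b) ⇔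
                         (σ ⟨$⟩ʳ a) < (σ ⟨$⟩ʳ b)

Avoids : ∀ {k N} → Permutation′ k → Permutation′ N → Set
Avoids σ w = ¬ Contains σ w

[321] : Permutation′ 3
[321] = permutation (Vec.lookup oneLine) (Vec.lookup oneLine) inv inv
  where
  oneLine : Vec (Fin 3) 3
  oneLine = 2F Vec.∷ 1F Vec.∷ 0F Vec.∷ Vec.[]

  inv : ∀ i → Vec.lookup oneLine (Vec.lookup oneLine i) ≡ i
  inv 0F = refl
  inv 1F = refl
  inv 2F = refl

[312] : Permutation′ 3
[312] = permutation (Vec.lookup oneLine) (Vec.lookup inverse) invˡ invʳ
  where
  oneLine inverse : Vec (Fin 3) 3
  oneLine = 2F Vec.∷ 0F Vec.∷ 1F Vec.∷ Vec.[]
  inverse = 1F Vec.∷ 2F Vec.∷ 0F Vec.∷ Vec.[]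

  invˡ : ∀ i → Vec.lookup oneLine (Vec.lookup inverse i) ≡ i
  invˡ 0F = refl
  invˡ 1F = refl
  invˡ 2F = refl

  invʳ : ∀ i → Vec.lookup inverse (Vec.lookup oneLine i) ≡ i
  invʳ 0F = refl
  invʳ 1F = refl
  invʳ 2F = refl

-- φ is a well-defined surjective morphism and Ψ a well-defined automorphism.

φ-cong : ∀ {n} {u v : Word n} → H₀._≈_ n u v → M._≈_ n (φ u) (φ v)
φ-cong (rel r)       = rel (hecke r)
φ-cong refl          = refl
φ-cong (sym p)       = sym (φ-cong p)
φ-cong (trans p q)   = trans (φ-cong p) (φ-cong q)
φ-cong (++-cong p q) = ++-cong (φ-cong p) (φ-cong q)

module _ (n : ℕ) where
  open MonoidMorphisms (H₀.rawMonoid n) (M.rawMonoid n)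

  φ-isMonoidHomomorphism : IsMonoidHomomorphism φ
  φ-isMonoidHomomorphism = record
    { isMagmaHomomorphism = record
      { isRelHomomorphism = record { cong = φ-cong }
      ; homo              = λ _ _ → refl
      }
    ; ε-homo = refl
    }

  φ-surjective : ∀ m → ∃ λ x → M._≈_ n (φ x) m
  φ-surjective m = m , refl

private
  toℕ+opposite : ∀ {n} (i : Fin n) → toℕ (opposite i) ℕ.+ suc (toℕ i) ≡ n
  toℕ+opposite i = ≡.trans (≡.cong (ℕ._+ suc (toℕ i)) (opposite-prop i))
                         (ℕ.m∸n+n≡m (toℕ<n i))

  opposite-adjacent : ∀ {n} (i j : Fin n) → toℕ j ≡ suc (toℕ i) →
                      toℕ (opposite i) ≡ suc (toℕ (opposite j))
  opposite-adjacent i j e = ℕ.+-cancelʳ-≡ (suc (toℕ i)) _ _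
    (≡.trans (toℕ+opposite i)
      (≡.trans (≡.sym (toℕ+opposite j))
        (≡.trans (ℕ.+-suc _ (toℕ j)) (≡.cong (λ k → suc (toℕ (opposite j) ℕ.+ k)) e))))

  opposite-distance : ∀ {n} (i j : Fin n) →
                      ∣ toℕ (opposite i) - toℕ (opposite j) ∣ ≡ ∣ toℕ i - toℕ j ∣
  opposite-distance {n} i j =
    ≡.trans (≡.sym (ℕ.∣m+n-m+o∣≡∣n-o∣ (suc (toℕ i) ℕ.+ suc (toℕ j)) a b))
      (≡.trans (≡.cong₂ ∣_-_∣ left right)
        (≡.trans (ℕ.∣m+n-m+o∣≡∣n-o∣ n (suc (toℕ j)) (suc (toℕ i)))
               (ℕ.∣-∣-comm (toℕ j) (toℕ i))))
    where
    a = toℕ (opposite i)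
    b = toℕ (opposite j)

    left : suc (toℕ i) ℕ.+ suc (toℕ j) ℕ.+ a ≡ n ℕ.+ suc (toℕ j)
    left = ≡.trans (ℕ.+-comm _ a)
      (≡.trans (≡.sym (ℕ.+-assoc a (suc (toℕ i)) (suc (toℕ j))))
             (≡.cong (ℕ._+ suc (toℕ j)) (toℕ+opposite i)))

    right : suc (toℕ i) ℕ.+ suc (toℕ j) ℕ.+ b ≡ n ℕ.+ suc (toℕ i)
    right = ≡.trans (ℕ.+-assoc (suc (toℕ i)) (suc (toℕ j)) b)
      (≡.trans (≡.cong (suc (toℕ i) ℕ.+_) (≡.trans (ℕ.+-comm (suc (toℕ j)) b) (toℕ+opposite j)))
             (ℕ.+-comm (suc (toℕ i)) n))

Ψ-cong : ∀ {n} {u v : Word n} → H₀._≈_ n u v → H₀._≈_ n (Ψ u) (Ψ v)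
Ψ-cong (rel (idem i))      = rel (idem (opposite i))
Ψ-cong (rel (comm i j d))  = rel (comm (opposite i) (opposite j)
  (≡.subst (2 ℕ.≤_) (≡.sym (opposite-distance i j)) d))
Ψ-cong (rel (braid i j e)) =
  sym (rel (braid (opposite j) (opposite i) (opposite-adjacent i j e)))
Ψ-cong refl                = refl
Ψ-cong (sym p)             = sym (Ψ-cong p)
Ψ-cong (trans p q)         = trans (Ψ-cong p) (Ψ-cong q)
Ψ-cong {n} (++-cong {u} {u′} {v} {v′} p q) =
  ≡.subst₂ (H₀._≈_ n) (≡.sym (map-++ opposite u v)) (≡.sym (map-++ opposite u′ v′))
         (++-cong (Ψ-cong p) (Ψ-cong q))

Ψ-involutive : ∀ {n} (u : Word n) → Ψ (Ψ u) ≡ u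
Ψ-involutive u = ≡.trans (≡.sym (map-∘ u)) (≡.trans (map-cong opposite-involutive u) (map-id u))

module _ (n : ℕ) where
  open MonoidMorphisms (H₀.rawMonoid n) (H₀.rawMonoid n)

  Ψ-isMonoidIsomorphism : IsMonoidIsomorphism Ψ
  Ψ-isMonoidIsomorphism = record
    { isMonoidMonomorphism = record
      { isMonoidHomomorphism = record
        { isMagmaHomomorphism = record
          { isRelHomomorphism = record { cong = Ψ-cong }
          ; homo              = λ u v → H₀.reflexive n (map-++ opposite u v)
          }
        ; ε-homo = refl
        }
      ; injective = λ {u} {v} p →
          ≡.subst₂ (H₀._≈_ n) (Ψ-involutive u) (Ψ-involutive v) (Ψ-cong p)
      }
    ; surjective = λ u → Ψ u , λ {v} p →
        ≡.subst (H₀._≈_ n (Ψ v)) (Ψ-involutive u) (Ψ-cong p)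
    }

{-# OPTIONS --safe #-}
module Submission where

-- Let e i : Fin N → Fin N move i to i + 1 and fix everything else, and let
-- eval (i₁ … i_k) = e i₁ ∘ … ∘ e i_k. Multiplying w on the right by s i at an
-- ascent changes its running maximum j ↦ max_{k ≤ j} w(k) by precomposition
-- with e i, so eval of a reduced word for w is the running maximum of w. As
-- the e i satisfy the relations of M after the flip Ψ, and as eval is
-- injective modulo these relations, G m consists of the permutations with one
-- prescribed running maximum. If w(a) exceeds w(b) and w(c) with a < b < c,
-- then swapping the entries at b and c keeps the running maximum and changes
-- the length strictly; this removes 321 patterns going down in length and 312
-- patterns going up. Two permutations with the same running maximum that
-- first disagree at j, u(j) < v(j), have a 312 in u and a 321 in v.

open import Defs
open import Data.Nat.Base as ℕ using (ℕ; suc; _≤_; _∸_; z≤n; s≤s)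
open import Data.Fin.Permutation as Perm using (Permutation′; _≈_; _⟨$⟩ʳ_; _⟨$⟩ˡ_; transpose)
open import Data.Product using (∃; ∃!; Σ; _×_; _,_; ∃₂; proj₁; proj₂)
open import Algebra.Bundles using (Monoid)
open import Data.Empty using (⊥; ⊥-elim)
open import Data.Fin.Base as Fin using (Fin; zero; suc; toℕ; opposite; inject₁; _<_)
import Data.Fin.Induction as Fin
open import Data.Fin.Patterns using (0F; 1F; 2F)
open import Data.Fin.Properties
  using (_≟_; _<?_; <-cmp; any?; all?; toℕ-injective; toℕ-inject₁; toℕ<n; opposite-prop; suc-injective)
open import Data.List.Base
  using (List; []; _∷_; [_]; _++_; _∷ʳ_; map; length; filter; allFin; cartesianProduct)
open import Data.List.Membership.Propositional using (_∈_)
open import Data.List.Membership.Propositional.Properties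
  using (∈-filter⁺; ∈-filter⁻; ∈-cartesianProduct⁺; ∈-allFin)
open import Data.List.Properties
  using (++-assoc; ++-identityʳ; map-++; length-++; length-filter; filter-≐)
open import Data.List.Relation.Unary.All as All using (_∷_)
open import Data.List.Relation.Unary.AllPairs using (_∷_)
open import Data.List.Relation.Unary.Any using (here; there)
open import Data.List.Relation.Unary.Unique.Propositional using (Unique)
import Data.List.Relation.Unary.Unique.Propositional.Properties as Unique
open import Data.List.Reverse using (Reverse; []; _∶_∶ʳ_; reverseView)
open import Data.Nat.Induction using (<-wellFounded)
import Data.Nat.Properties as ℕ
open import Data.Sum using (_⊎_; inj₁; inj₂)
open import Data.Vec.Base using (lookup; []; _∷_)
open import Data.Vec.Properties using (lookup∘tabulate)
open import Function.Base using (_∘_; id; _$_)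
open import Function.Bundles using (mk⇔; Equivalence)
open import Induction.WellFounded using (Acc; acc)
open import Level using (0ℓ)
open import Relation.Binary.Core using (Rel)
open import Relation.Binary.Definitions using (tri<; tri≈; tri>)
open import Relation.Binary.PropositionalEquality as ≡ using (_≡_; _≢_; _≗_; refl; cong)
import Relation.Binary.Reasoning.Setoid as SetoidReasoning
open import Relation.Nullary using (¬_; Dec; yes; no; contradiction; _×-dec_; _→-dec_)
open import Relation.Nullary.Decidable using (map′)

private variable
  n N : ℕ
  A B : Set

-- The presentation of M

-- The universal property of a presentation, used for `Ψ`, for `map suc` and for comparing two
-- presentations on the same letters.
Congruence-homo : {R : Rel (List A) 0ℓ} {S : Rel (List B) 0ℓ} (f : List A → List B) →
  (∀ u v → f (u ++ v) ≡ f u ++ f v) →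
  (∀ {u v} → R u v → Congruence S (f u) (f v)) →
  ∀ {u v} → Congruence R u v → Congruence S (f u) (f v)
Congruence-homo f homo resp (rel r)     = resp r
Congruence-homo f homo resp refl        = refl
Congruence-homo f homo resp (sym p)     = sym (Congruence-homo f homo resp p)
Congruence-homo f homo resp (trans p q) =
  trans (Congruence-homo f homo resp p) (Congruence-homo f homo resp q)
Congruence-homo {S = S} f homo resp (++-cong {u} {u′} {v} {v′} p q) =
  ≡.subst₂ (Congruence S) (≡.sym (homo u v)) (≡.sym (homo u′ v′))
    (++-cong (Congruence-homo f homo resp p) (Congruence-homo f homo resp q))

-- Ψ exchanges the relations of M n with these.
data FlipRel {n : ℕ} : Rel (Word n) 0ℓ where
  hecke : ∀ {u v} → HeckeRel u v → FlipRel u v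
  quot  : ∀ i j → toℕ j ≡ suc (toℕ i) → FlipRel (j ∷ i ∷ j ∷ []) (j ∷ i ∷ [])

infix 4 _≋_
_≋_ : Rel (Word n) 0ℓ
_≋_ = Congruence FlipRel

opposite-adjacent : (i j : Fin n) → toℕ j ≡ suc (toℕ i) →
                    toℕ (opposite i) ≡ suc (toℕ (opposite j))
opposite-adjacent {n} i j e rewrite opposite-prop i | opposite-prop j | ≡.sym e =
  ℕ.+-∸-assoc 1 (toℕ<n j)

M⇒≋ : ∀ {u v : Word n} → M._≈_ n u v → Ψ u ≋ Ψ v
M⇒≋ = Congruence-homo Ψ (map-++ opposite) λ where
  (hecke r)    → Congruence-homo id (λ _ _ → refl) (rel ∘ hecke) (Ψ-cong (rel r))
  -- The flip makes `opposite i` the larger of the two adjacent letters, hence the exchanged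
  -- arguments.
  (quot i j e) → rel (quot (opposite j) (opposite i) (opposite-adjacent i j e))

≋⇒M : ∀ {u v : Word n} → u ≋ v → M._≈_ n (Ψ u) (Ψ v)
≋⇒M = Congruence-homo Ψ (map-++ opposite) λ where
  (hecke r)    → φ-cong (Ψ-cong (rel r))
  (quot i j e) → rel (quot (opposite j) (opposite i) (opposite-adjacent i j e))

map-suc-cong : ∀ {u v : Word n} → u ≋ v → map suc u ≋ map suc v
map-suc-cong = Congruence-homo (map suc) (map-++ suc) λ where
  (hecke (idem i))      → rel (hecke (idem (suc i)))
  (hecke (comm i j d))  → rel (hecke (comm (suc i) (suc j) d))
  (hecke (braid i j e)) → rel (hecke (braid (suc i) (suc j) (cong suc e)))
  (quot i j e)          → rel (quot (suc i) (suc j) (cong suc e))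

-- The action of words by the maps `e i`

e : Fin n → Fin (suc n) → Fin (suc n)
e zero    zero    = suc zero
e zero    (suc x) = suc x
e (suc i) zero    = zero
e (suc i) (suc x) = suc (e i x)

eval : Word n → Fin (suc n) → Fin (suc n)
eval []      = id
eval (i ∷ u) = e i ∘ eval u

eval-++ : ∀ (u v : Word n) x → eval (u ++ v) x ≡ eval u (eval v x)
eval-++ []      v x = refl
eval-++ (i ∷ u) v x = cong (e i) (eval-++ u v x)

eval-map-suc-zero : ∀ (u : Word n) → eval (map suc u) zero ≡ zero
eval-map-suc-zero []      = refl
eval-map-suc-zero (i ∷ u) = cong (e (suc i)) (eval-map-suc-zero u)

eval-map-suc-suc : ∀ (u : Word n) x → eval (map suc u) (suc x) ≡ suc (eval u x)
eval-map-suc-suc []      x = refl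
eval-map-suc-suc (i ∷ u) x = cong (e (suc i)) (eval-map-suc-suc u x)

-- As `e` recurses on the index, this and the next three relations reduce to the case where the
-- smaller letter is `zero`.
e-idem : (i : Fin n) → e i ∘ e i ≗ e i
e-idem zero    zero    = refl
e-idem zero    (suc x) = refl
e-idem (suc i) zero    = refl
e-idem (suc i) (suc x) = cong suc (e-idem i x)

e-comm : (i j : Fin n) → 2 ≤ ℕ.∣ toℕ i - toℕ j ∣ → e i ∘ e j ≗ e j ∘ e i
e-comm zero          (suc (suc j)) _ zero    = refl
e-comm zero          (suc (suc j)) _ (suc x) = refl
e-comm (suc (suc i)) zero          _ zero    = refl
e-comm (suc (suc i)) zero          _ (suc x) = refl
e-comm (suc i)       (suc j)       d zero    = refl
e-comm (suc i)       (suc j)       d (suc x) = cong suc (e-comm i j d x)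
e-comm zero          (suc zero)    (s≤s ())
e-comm (suc zero)    zero          (s≤s ())

e-braid : (i j : Fin n) → toℕ j ≡ suc (toℕ i) → e i ∘ e j ∘ e i ≗ e j ∘ e i
e-braid zero    (suc zero) _ zero          = refl
e-braid zero    (suc zero) _ (suc zero)    = refl
e-braid zero    (suc zero) _ (suc (suc x)) = refl
e-braid (suc i) (suc j)    p zero          = refl
e-braid (suc i) (suc j)    p (suc x)       = cong suc (e-braid i j (ℕ.suc-injective p) x)

e-quot : (i j : Fin n) → toℕ j ≡ suc (toℕ i) → e j ∘ e i ∘ e j ≗ e j ∘ e i
e-quot zero    (suc zero) _ zero          = refl
e-quot zero    (suc zero) _ (suc zero)    = refl
e-quot zero    (suc zero) _ (suc (suc x)) = refl
e-quot (suc i) (suc j)    p zero          = refl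
e-quot (suc i) (suc j)    p (suc x)       = cong suc (e-quot i j (ℕ.suc-injective p) x)

eval-cong : ∀ {u v : Word n} → u ≋ v → eval u ≗ eval v
eval-cong (rel (hecke (idem i)))      = e-idem i
eval-cong (rel (hecke (comm i j d)))  = e-comm i j d
-- Both sides of the braid relation act as `e j ∘ e i`.
eval-cong (rel (hecke (braid i j p))) x = ≡.trans (e-braid i j p x) (≡.sym (e-quot i j p x))
eval-cong (rel (quot i j p))          = e-quot i j p
eval-cong refl                        x = refl
eval-cong (sym p)                     x = ≡.sym (eval-cong p x)
eval-cong (trans p q)                 x = ≡.trans (eval-cong p x) (eval-cong q x)
eval-cong (++-cong {u} {u′} {v} {v′} p q) x = begin
  eval (u ++ v) x     ≡⟨ eval-++ u v x ⟩
  eval u (eval v x)   ≡⟨ eval-cong p (eval v x) ⟩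
  eval u′ (eval v x)  ≡⟨ cong (eval u′) (eval-cong q x) ⟩
  eval u′ (eval v′ x) ≡⟨ eval-++ u′ v′ x ⟨
  eval (u′ ++ v′) x   ∎
  where open ≡.≡-Reasoning

-- column p is the word (p - 1) … 1 0.
column : Fin (suc n) → Word n
column         zero    = []
column {suc n} (suc p) = map suc (column p) ++ [ zero ]

eval-column-zero : (p : Fin (suc n)) → eval (column p) zero ≡ p
eval-column-zero         zero    = refl
eval-column-zero {suc n} (suc p) = begin
  eval (map suc (column p) ++ [ zero ]) zero ≡⟨ eval-++ (map suc (column p)) [ zero ] zero ⟩
  eval (map suc (column p)) (suc zero)       ≡⟨ eval-map-suc-suc (column p) zero ⟩
  suc (eval (column p) zero)                 ≡⟨ cong suc (eval-column-zero p) ⟩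
  suc p                                      ∎
  where open ≡.≡-Reasoning

-- Shifted letters fix `zero`, so the value at `zero` reveals the column of a factored word.
eval-column-++-zero : ∀ (p : Fin (suc (suc n))) (u : Word n) →
  eval (column p ++ map suc u) zero ≡ p
eval-column-++-zero p u = begin
  eval (column p ++ map suc u) zero        ≡⟨ eval-++ (column p) (map suc u) zero ⟩
  eval (column p) (eval (map suc u) zero)  ≡⟨ cong (eval (column p)) (eval-map-suc-zero u) ⟩
  eval (column p) zero                     ≡⟨ eval-column-zero p ⟩
  p                                        ∎
  where open ≡.≡-Reasoning

-- The final letter `zero` of the column fixes every successor, so on successors only letters of the
-- form `suc i` act, and the index can drop by one.
eval-column-++-suc : ∀ (p : Fin (suc n)) (u : Word n) x →
  eval (column (suc p) ++ map suc u) (suc x) ≡ suc (eval (column p ++ u) x)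
eval-column-++-suc p u x = begin
  eval (column (suc p) ++ map suc u) (suc x)
    ≡⟨ eval-++ (column (suc p)) (map suc u) (suc x) ⟩
  eval (column (suc p)) (eval (map suc u) (suc x))
    ≡⟨ cong (eval (column (suc p))) (eval-map-suc-suc u x) ⟩
  eval (map suc (column p) ++ [ zero ]) (suc (eval u x))
    ≡⟨ eval-++ (map suc (column p)) [ zero ] _ ⟩
  eval (map suc (column p)) (suc (eval u x))
    ≡⟨ eval-map-suc-suc (column p) (eval u x) ⟩
  suc (eval (column p) (eval u x))
    ≡⟨ cong suc (eval-++ (column p) u x) ⟨
  suc (eval (column p ++ u) x) ∎
  where open ≡.≡-Reasoning

-- Factoring words into columns

module ≋-Reasoning {n} = SetoidReasoning (Monoid.setoid (Presented (FlipRel {n})))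

++-congˡ : ∀ (w : Word n) {u v} → u ≋ v → w ++ u ≋ w ++ v
++-congˡ w p = ++-cong (refl {u = w}) p

++-congʳ : ∀ (w : Word n) {u v} → u ≋ v → u ++ w ≋ v ++ w
++-congʳ w p = ++-cong p (refl {u = w})

zero-comm : ∀ (u : Word n) →
  zero ∷ map suc (map suc u) ≋ map suc (map suc u) ++ [ zero ]
zero-comm []      = refl
zero-comm (i ∷ u) = trans
  (++-congʳ (map suc (map suc u)) (rel (hecke (comm zero (suc (suc i)) (s≤s (s≤s z≤n))))))
  (++-congˡ [ suc (suc i) ] (zero-comm u))

-- The inner `zero` commutes past the letters from two on, the shifted induction hypothesis removes
-- the second copy of `d`, and the remaining 1 0 1 collapses to 1 0.
column-absorb : ∀ (p : Fin (suc n)) →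
  column (suc p) ++ map suc (column p) ≋ column (suc p)
column-absorb zero = refl
column-absorb {suc n} (suc p) = begin
  (map suc (map suc c ++ [ zero ]) ++ [ zero ]) ++ map suc (map suc c ++ [ zero ])
    ≡⟨ ≡.cong₂ (λ x y → (x ++ [ zero ]) ++ y) (map-++ suc (map suc c) _) (map-++ suc (map suc c) _) ⟩
  ((d ++ [ one ]) ++ [ zero ]) ++ (d ++ [ one ])
    ≡⟨ ++-assoc (d ++ [ one ]) [ zero ] _ ⟩
  (d ++ [ one ]) ++ ((zero ∷ d) ++ [ one ])
    ≈⟨ ++-congˡ (d ++ [ one ]) (++-congʳ [ one ] (zero-comm c)) ⟩
  (d ++ [ one ]) ++ ((d ++ [ zero ]) ++ [ one ])
    ≡⟨ cong ((d ++ [ one ]) ++_) (++-assoc d [ zero ] [ one ]) ⟩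
  (d ++ [ one ]) ++ (d ++ (zero ∷ one ∷ []))
    ≡⟨ ++-assoc (d ++ [ one ]) d _ ⟨
  ((d ++ [ one ]) ++ d) ++ (zero ∷ one ∷ [])
    ≈⟨ ++-congʳ (zero ∷ one ∷ []) shifted ⟩
  (d ++ [ one ]) ++ (zero ∷ one ∷ [])
    ≡⟨ ++-assoc d [ one ] _ ⟩
  d ++ (one ∷ zero ∷ one ∷ [])
    ≈⟨ ++-congˡ d (rel (quot zero one refl)) ⟩
  d ++ (one ∷ zero ∷ [])
    ≡⟨ ++-assoc d [ one ] [ zero ] ⟨
  (d ++ [ one ]) ++ [ zero ]
    ≡⟨ cong (_++ [ zero ]) (map-++ suc (map suc c) _) ⟨
  map suc (map suc c ++ [ zero ]) ++ [ zero ] ∎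
  where
  open ≋-Reasoning
  one = suc zero
  c   = column p
  d   = map suc (map suc c)

  shifted : (d ++ [ one ]) ++ d ≋ d ++ [ one ]
  shifted = ≡.subst₂ _≋_
    (≡.trans (map-++ suc (column (suc p)) (map suc c)) (cong (_++ d) (map-++ suc (map suc c) _)))
    (map-++ suc (map suc c) _)
    (map-suc-cong (column-absorb p))

-- The letter `zero` starts a column or is absorbed. A letter `suc k` acts on the shifted part of
-- the column by recursion; the surplus then consists of letters from two on, so the final `zero`
-- commutes past it and completes the new column.
prepend : ∀ (i : Fin (suc n)) (p : Fin (suc (suc n))) →
  ∃₂ λ q u → i ∷ column p ≋ column q ++ map suc u
prepend zero    zero       = suc zero , [] , refl
prepend (suc k) zero       = zero , [ k ] , refl
prepend zero    (suc zero) = suc zero , [] , rel (hecke (idem zero))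
prepend {suc n} zero (suc (suc p)) = suc (suc p) , [] , (begin
  zero ∷ (map suc (map suc c ++ [ zero ]) ++ [ zero ])
    ≡⟨ cong (λ x → zero ∷ (x ++ [ zero ])) (map-++ suc (map suc c) _) ⟩
  zero ∷ ((d ++ [ one ]) ++ [ zero ])
    ≡⟨ cong (zero ∷_) (++-assoc d [ one ] [ zero ]) ⟩
  (zero ∷ d) ++ (one ∷ zero ∷ [])
    ≈⟨ ++-congʳ (one ∷ zero ∷ []) (zero-comm c) ⟩
  (d ++ [ zero ]) ++ (one ∷ zero ∷ [])
    ≡⟨ ++-assoc d [ zero ] _ ⟩
  d ++ (zero ∷ one ∷ zero ∷ [])
    -- The braid relation turns 0 1 0 into 1 0 1, and the quotient relation shortens this to 1 0.
    ≈⟨ ++-congˡ d (trans (rel (hecke (braid zero one refl))) (rel (quot zero one refl))) ⟩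
  d ++ (one ∷ zero ∷ [])
    ≡⟨ ++-assoc d [ one ] [ zero ] ⟨
  (d ++ [ one ]) ++ [ zero ]
    ≡⟨ cong (_++ [ zero ]) (map-++ suc (map suc c) _) ⟨
  map suc (map suc c ++ [ zero ]) ++ [ zero ]
    ≡⟨ ++-identityʳ _ ⟨
  (map suc (map suc c ++ [ zero ]) ++ [ zero ]) ++ [] ∎)
  where
  open ≋-Reasoning
  one = suc zero
  c   = column p
  d   = map suc (map suc c)
prepend {suc n} (suc k) (suc p) =
  let q , u , eq = prepend k p
      d = map suc (column q)
      v = map suc (map suc u)
  in suc q , map suc u , (begin
  map suc (k ∷ column p) ++ [ zero ]              ≈⟨ ++-congʳ [ zero ] (map-suc-cong eq) ⟩
  map suc (column q ++ map suc u) ++ [ zero ]     ≡⟨ cong (_++ [ zero ]) (map-++ suc (column q) _) ⟩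
  (d ++ v) ++ [ zero ]                            ≡⟨ ++-assoc d v _ ⟩
  d ++ (v ++ [ zero ])                            ≈⟨ ++-congˡ d (zero-comm u) ⟨
  d ++ (zero ∷ v)                                 ≡⟨ ++-assoc d [ zero ] v ⟨
  (d ++ [ zero ]) ++ v                            ∎)
  where open ≋-Reasoning

factor : ∀ (u : Word (suc n)) → ∃₂ λ p v → u ≋ column p ++ map suc v
factor []      = zero , [] , refl
factor (i ∷ u) =
  let p , v , u≋  = factor u
      q , w , ip≋ = prepend i p
  in q , w ++ v , (begin
  i ∷ u                              ≈⟨ ++-congˡ [ i ] u≋ ⟩
  (i ∷ column p) ++ map suc v        ≈⟨ ++-congʳ (map suc v) ip≋ ⟩
  (column q ++ map suc w) ++ map suc v ≡⟨ ++-assoc (column q) _ _ ⟩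
  column q ++ (map suc w ++ map suc v) ≡⟨ cong (column q ++_) (map-++ suc w v) ⟨
  column q ++ map suc (w ++ v)         ∎)
  where open ≋-Reasoning

-- Induction on the number of generators: the values at `zero` force equal columns in the
-- factorizations, and the values at successors determine the rest.
eval-injective : ∀ {n} {u v : Word n} → eval u ≗ eval v → u ≋ v

-- The action of a column is not invertible, so `u` and `v` need not be congruent. The values at
-- successors only see `column p ++ u` and `column p ++ v`; `column-absorb` allows `column p` to be
-- inserted before both words and removed again.
column-cancel : ∀ (p : Fin (suc (suc n))) {u v : Word n} →
  eval (column p ++ map suc u) ≗ eval (column p ++ map suc v) →
  column p ++ map suc u ≋ column p ++ map suc v
column-cancel zero {u} {v} eq = map-suc-cong (eval-injective λ x → suc-injective
  (≡.trans (≡.sym (eval-map-suc-suc u x)) (≡.trans (eq (suc x)) (eval-map-suc-suc v x))))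
column-cancel (suc p) {u} {v} eq = begin
  column (suc p) ++ map suc u              ≈⟨ insert u ⟨
  column (suc p) ++ map suc (column p ++ u) ≈⟨ ++-congˡ (column (suc p)) (map-suc-cong
    (eval-injective λ x → suc-injective
      (≡.trans (≡.sym (eval-column-++-suc p u x)) (≡.trans (eq (suc x)) (eval-column-++-suc p v x))))) ⟩
  column (suc p) ++ map suc (column p ++ v) ≈⟨ insert v ⟩
  column (suc p) ++ map suc v              ∎
  where
  open ≋-Reasoning
  insert : ∀ w → column (suc p) ++ map suc (column p ++ w) ≋ column (suc p) ++ map suc w
  insert w = begin
    column (suc p) ++ map suc (column p ++ w)
      ≡⟨ cong (column (suc p) ++_) (map-++ suc (column p) w) ⟩
    column (suc p) ++ (map suc (column p) ++ map suc w)
      ≡⟨ ++-assoc (column (suc p)) _ _ ⟨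
    (column (suc p) ++ map suc (column p)) ++ map suc w
      ≈⟨ ++-congʳ (map suc w) (column-absorb p) ⟩
    column (suc p) ++ map suc w ∎

eval-injective {ℕ.zero} {[]} {[]} _ = refl
eval-injective {suc n} {u} {v} eq = 
  let p , u′ , u≋ = factor u
      q , v′ , v≋ = factor v
      eq′ : eval (column p ++ map suc u′) ≗ eval (column q ++ map suc v′)
      eq′ x = ≡.trans (≡.sym (eval-cong u≋ x)) (≡.trans (eq x) (eval-cong v≋ x))
      p≡q = ≡.trans (≡.sym (eval-column-++-zero p u′))
              (≡.trans (eq′ zero) (eval-column-++-zero q v′))
  in trans u≋ (trans (step p≡q eq′) (sym v≋))
  where
  step : ∀ {p q : Fin (suc (suc n))} {u v : Word n} → p ≡ q →
    eval (column p ++ map suc u) ≗ eval (column q ++ map suc v) →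
    column p ++ map suc u ≋ column q ++ map suc v
  step {p} refl = column-cancel p

-- Transpositions

⟨$⟩ʳ-injective : (w : Permutation′ N) → ∀ {j k} → w ⟨$⟩ʳ j ≡ w ⟨$⟩ʳ k → j ≡ k
⟨$⟩ʳ-injective w eq =
  ≡.trans (≡.sym (Perm.inverseˡ w)) (≡.trans (cong (w ⟨$⟩ˡ_) eq) (Perm.inverseˡ w))

-- The graph of the transposition as an inductive family: matching on it identifies moved points
-- with `b` and `c`.
data Transposed (b c : Fin N) : Fin N → Fin N → Set where
  left  : Transposed b c b c
  right : Transposed b c c b
  fixed : ∀ {k} → k ≢ b → k ≢ c → Transposed b c k k

transposed : ∀ (b c k : Fin N) → Transposed b c k (transpose b c ⟨$⟩ʳ k)
transposed b c k with k ≟ b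
... | yes refl = left
... | no k≢b with k ≟ c
...   | yes refl = right
...   | no k≢c   = fixed k≢b k≢c

transpose-unique : ∀ {b c k l : Fin N} → Transposed b c k l → transpose b c ⟨$⟩ʳ k ≡ l
transpose-unique {b = b} {c} {k} t with transpose b c ⟨$⟩ʳ k | transposed b c k | t
... | _ | left        | left        = refl
... | _ | left        | right       = refl
... | _ | left        | fixed b≢b _ = contradiction refl b≢b
... | _ | right       | left        = refl
... | _ | right       | right       = refl
... | _ | right       | fixed _ c≢c = contradiction refl c≢c
... | _ | fixed b≢b _ | left        = contradiction refl b≢b
... | _ | fixed _ c≢c | right       = contradiction refl c≢c
... | _ | fixed _ _   | fixed _ _   = refl

transpose-left : ∀ (b c : Fin N) → transpose b c ⟨$⟩ʳ b ≡ c
transpose-left b c = transpose-unique (left {b = b} {c})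

transpose-right : ∀ (b c : Fin N) → transpose b c ⟨$⟩ʳ c ≡ b
transpose-right b c = transpose-unique (right {b = b} {c})

transpose-involutive : ∀ (b c k : Fin N) → transpose b c ⟨$⟩ʳ (transpose b c ⟨$⟩ʳ k) ≡ k
transpose-involutive b c k = transpose-unique (flipped (transposed b c k))
  where
  flipped : ∀ {b c k l : Fin N} → Transposed b c k l → Transposed b c l k
  flipped left              = right
  flipped right             = left
  flipped (fixed k≢b k≢c) = fixed k≢b k≢c

transposed-reverses : ∀ {b c x x′ y y′ : Fin N} → b < c → x < y →
  Transposed b c x x′ → Transposed b c y y′ → y′ < x′ →
  (x ≡ b × y Fin.≤ c) ⊎ (y ≡ c × b Fin.≤ x)
transposed-reverses b<c x<y left left                y′<x′ = contradiction x<y (ℕ.<-irrefl refl)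
transposed-reverses b<c x<y left right               y′<x′ = inj₁ (refl , ℕ.≤-refl)
transposed-reverses b<c x<y left (fixed _ _)         y′<x′ = inj₁ (refl , ℕ.<⇒≤ y′<x′)
transposed-reverses b<c x<y right left               y′<x′ = contradiction b<c (ℕ.<-asym x<y)
transposed-reverses b<c x<y right right              y′<x′ = contradiction x<y (ℕ.<-irrefl refl)
transposed-reverses b<c x<y right (fixed _ _)        y′<x′ = contradiction (ℕ.<-trans b<c x<y) (ℕ.<-asym y′<x′)
transposed-reverses b<c x<y (fixed _ _) left         y′<x′ = contradiction (ℕ.<-trans b<c y′<x′) (ℕ.<-asym x<y)
transposed-reverses b<c x<y (fixed _ _) right        y′<x′ = inj₂ (refl , ℕ.<⇒≤ y′<x′)
transposed-reverses b<c x<y (fixed _ _) (fixed _ _)  y′<x′ = contradiction y′<x′ (ℕ.<-asym x<y)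

-- Controls prefixes: the swap takes a point out of the initial segment up to `j` in one way only,
-- which the callers treat separately.
transposed-exceeds : ∀ {b c k k′ j : Fin N} → b < c → Transposed b c k k′ →
  k Fin.≤ j → j < k′ → k ≡ b × k′ ≡ c
transposed-exceeds b<c left        k≤j j<k′ = refl , refl
transposed-exceeds b<c right       k≤j j<k′ = contradiction (ℕ.<-trans j<k′ b<c) (ℕ.≤⇒≯ k≤j)
transposed-exceeds b<c (fixed _ _) k≤j j<k′ = contradiction j<k′ (ℕ.≤⇒≯ k≤j)

-- Running maxima

-- Characterized by bound and attainment instead of computed, so that a change of `w` only has to
-- transport witnesses.
record RunningMax (w : Permutation′ N) (f : Fin N → Fin N) : Set where
  field
    upper    : ∀ {k j} → k Fin.≤ j → (w ⟨$⟩ʳ k) Fin.≤ f j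
    attained : ∀ j → ∃ λ k → k Fin.≤ j × w ⟨$⟩ʳ k ≡ f j

open RunningMax

RunningMax-unique : ∀ {w : Permutation′ N} {f g} → RunningMax w f → RunningMax w g → f ≗ g
RunningMax-unique F G j = toℕ-injective (ℕ.≤-antisym (below F G) (below G F))
  where
  below : ∀ {w : Permutation′ N} {f g} → RunningMax w f → RunningMax w g → ∀ {j} → f j Fin.≤ g j
  below F G {j} with attained F j
  ... | k , k≤j , eq = ≡.subst (Fin._≤ _) eq (upper G k≤j)

RunningMax-cong : ∀ {w : Permutation′ N} {f g} → f ≗ g → RunningMax w f → RunningMax w g
RunningMax-cong {w = w} f≗g F .upper {k} {j} k≤j = ≡.subst ((w ⟨$⟩ʳ k) Fin.≤_) (f≗g j) (upper F k≤j)
RunningMax-cong f≗g F .attained j = let k , k≤j , eq = attained F j in k , k≤j , ≡.trans eq (f≗g j)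

RunningMax-resp-≈ : ∀ {w v : Permutation′ N} {f} → w ≈ v → RunningMax w f → RunningMax v f
RunningMax-resp-≈ w≈v F .upper {k} k≤j = ≡.subst (Fin._≤ _) (w≈v k) (upper F k≤j)
RunningMax-resp-≈ w≈v F .attained j =
  let k , k≤j , eq = attained F j in k , k≤j , ≡.trans (≡.sym (w≈v k)) eq

-- Prefixes ending before `a` contain neither swapped entry. From `a` on the maximum is at least
-- `w(a)`, so neither entry attains it.
RunningMax-transpose : ∀ {w : Permutation′ N} {f a b c} → a < b → b < c →
  w ⟨$⟩ʳ b < w ⟨$⟩ʳ a → w ⟨$⟩ʳ c < w ⟨$⟩ʳ a →
  RunningMax w f → RunningMax (w · transpose b c) f
RunningMax-transpose {w = w} {f} {a} {b} {c} a<b b<c wb<wa wc<wa F = record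
  { upper = λ {k} {j} k≤j → bound k≤j (transposed b c k) ; attained = att }
  where
  bound : ∀ {k k′ j} → k Fin.≤ j → Transposed b c k k′ → (w ⟨$⟩ʳ k′) Fin.≤ f j
  bound {k} {k′} {j} k≤j t with j <? k′
  ... | no j≮k′ = upper F (ℕ.≮⇒≥ j≮k′)
  ... | yes j<k′ with transposed-exceeds b<c t k≤j j<k′
  ...   | refl , refl = ℕ.≤-trans (ℕ.<⇒≤ wc<wa) (upper F (ℕ.≤-trans (ℕ.<⇒≤ a<b) k≤j))

  att : ∀ j → ∃ λ k → k Fin.≤ j × w ⟨$⟩ʳ (transpose b c ⟨$⟩ʳ k) ≡ f j
  att j with attained F j
  ... | k , k≤j , eq with j <? (transpose b c ⟨$⟩ʳ k)
  ...   | no j≮τk  = transpose b c ⟨$⟩ʳ k , ℕ.≮⇒≥ j≮τk ,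
                     ≡.trans (cong (w ⟨$⟩ʳ_) (transpose-involutive b c k)) eq
  ...   | yes j<τk with transposed-exceeds b<c (transposed b c k) k≤j j<τk
  ...     | refl , _ = contradiction
            (≡.subst ((w ⟨$⟩ʳ a) Fin.≤_) (≡.sym eq) (upper F (ℕ.≤-trans (ℕ.<⇒≤ a<b) k≤j)))
            (ℕ.<⇒≱ wb<wa)

inject₁<suc : ∀ (i : Fin n) → inject₁ i < suc i
inject₁<suc i = s≤s (ℕ.≤-reflexive (toℕ-inject₁ i))

e-moves : ∀ (i : Fin n) → e i (inject₁ i) ≡ suc i
e-moves zero    = refl
e-moves (suc i) = cong suc (e-moves i)

e-fixes : ∀ (i : Fin n) {j} → j ≢ inject₁ i → e i j ≡ j
e-fixes zero    {zero}  j≢ = contradiction refl j≢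
e-fixes zero    {suc j} j≢ = refl
e-fixes (suc i) {zero}  j≢ = refl
e-fixes (suc i) {suc j} j≢ = cong suc (e-fixes i (j≢ ∘ cong suc))

-- Only the prefix ending at `inject₁ i` changes its set of entries: the larger of the two entries
-- replaces the smaller, so its maximum becomes that of the prefix ending at `suc i`.
RunningMax-ascent : ∀ {w : Permutation′ (suc n)} {f} (i : Fin n) →
  w ⟨$⟩ʳ inject₁ i < w ⟨$⟩ʳ suc i → RunningMax w f → RunningMax (w · s i) (f ∘ e i)
RunningMax-ascent {n} {w} {f} i asc F = record { upper = up ; attained = att }
  where
  b = inject₁ i
  c = suc i
  b<c = inject₁<suc i

  stays : ∀ {k k′ j} → j ≢ b → Transposed b c k k′ → k Fin.≤ j → k′ Fin.≤ j
  stays {k} {k′} {j} j≢b t k≤j with j <? k′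
  ... | no j≮k′ = ℕ.≮⇒≥ j≮k′
  ... | yes j<k′ with transposed-exceeds b<c t k≤j j<k′
  ...   | refl , refl = contradiction
          (toℕ-injective (ℕ.≤-antisym (≡.subst (toℕ j ≤_) (≡.sym (toℕ-inject₁ i)) (ℕ.s≤s⁻¹ j<k′)) k≤j)) j≢b

  upto-c : ∀ {k k′} → Transposed b c k k′ → k Fin.≤ b → k′ Fin.≤ c
  upto-c left        k≤b = ℕ.≤-refl
  upto-c right       k≤b = ℕ.<⇒≤ b<c
  upto-c (fixed _ _) k≤b = ℕ.≤-trans k≤b (ℕ.<⇒≤ b<c)

  upto-b : ∀ {k k′} → k ≢ b → Transposed b c k k′ → k Fin.≤ c → k′ Fin.≤ b
  upto-b k≢b left          k≤c = contradiction refl k≢b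
  upto-b k≢b right         k≤c = ℕ.≤-refl
  upto-b k≢b (fixed _ k≢c) k≤c = ≡.subst (_ ≤_) (≡.sym (toℕ-inject₁ i))
    (ℕ.s≤s⁻¹ (ℕ.≤∧≢⇒< k≤c (k≢c ∘ toℕ-injective)))

  up : ∀ {k j} → k Fin.≤ j → (w ⟨$⟩ʳ (s i ⟨$⟩ʳ k)) Fin.≤ f (e i j)
  up {k} {j} k≤j with j ≟ b
  ... | yes refl rewrite e-moves i       = upper F (upto-c (transposed b c k) k≤j)
  ... | no j≢b   rewrite e-fixes i j≢b = upper F (stays j≢b (transposed b c k) k≤j)

  pull : ∀ {k} → w ⟨$⟩ʳ (s i ⟨$⟩ʳ (s i ⟨$⟩ʳ k)) ≡ w ⟨$⟩ʳ k
  pull {k} = cong (w ⟨$⟩ʳ_) (transpose-involutive b c k)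

  att : ∀ j → ∃ λ k → k Fin.≤ j × w ⟨$⟩ʳ (s i ⟨$⟩ʳ k) ≡ f (e i j)
  att j with j ≟ b
  att j | no j≢b rewrite e-fixes i j≢b =
    let k , k≤j , eq = attained F j
    in s i ⟨$⟩ʳ k , stays j≢b (transposed b c k) k≤j , ≡.trans pull eq
  att j | yes refl rewrite e-moves i with attained F c
  ... | k , k≤c , eq with k ≟ b
  -- The smaller entry sits at `inject₁ i`, so the maximum up to `suc i` is attained elsewhere.
  ...   | yes refl = contradiction asc
          (ℕ.≤⇒≯ (≡.subst ((w ⟨$⟩ʳ c) Fin.≤_) (≡.sym eq) (upper F ℕ.≤-refl)))
  ...   | no k≢b   = s i ⟨$⟩ʳ k , upto-b k≢b (transposed b c k) k≤c , ≡.trans pull eq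
-- Words

⟦⟧-++ : ∀ (u v : Word n) → ⟦ u ++ v ⟧ ≈ ⟦ u ⟧ · ⟦ v ⟧
⟦⟧-++ []      v j = refl
⟦⟧-++ (i ∷ u) v j = cong (s i ⟨$⟩ʳ_) (⟦⟧-++ u v j)

length-∷ʳ : ∀ (u : List A) x → length (u ∷ʳ x) ≡ suc (length u)
length-∷ʳ u x = ≡.trans (length-++ u) (ℕ.+-comm (length u) 1)

-- Conjugating `s i` by `w` gives the transposition of the values `w(i)` and `w(i+1)`, which is
-- `s k`, so the two swaps cancel.
s-conjugate : ∀ {i k : Fin n} (w : Permutation′ (suc n)) →
  w ⟨$⟩ʳ inject₁ i ≡ inject₁ k → w ⟨$⟩ʳ suc i ≡ suc k → s k · w · s i ≈ w
s-conjugate {i = i} {k} w wb wc j = conj (transposed (inject₁ i) (suc i) j)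
  where
  conj : ∀ {j j′} → Transposed (inject₁ i) (suc i) j j′ → s k ⟨$⟩ʳ (w ⟨$⟩ʳ j′) ≡ w ⟨$⟩ʳ j
  conj left  rewrite wb | wc = transpose-right (inject₁ k) (suc k)
  conj right rewrite wb | wc = transpose-left (inject₁ k) (suc k)
  conj (fixed j≢b j≢c) = transpose-unique (fixed
    (λ eq → j≢b (⟨$⟩ʳ-injective w (≡.trans eq (≡.sym wb))))
    (λ eq → j≢c (⟨$⟩ʳ-injective w (≡.trans eq (≡.sym wc)))))

-- No point lies strictly between adjacent ones, so either alternative of `transposed-reverses`
-- leaves only the swapped pair.
s-reverses : ∀ (k : Fin n) {x y} → x < y → s k ⟨$⟩ʳ y < s k ⟨$⟩ʳ x → x ≡ inject₁ k × y ≡ suc k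
s-reverses k {x} {y} x<y y′<x′
  with transposed-reverses (inject₁<suc k) x<y
         (transposed (inject₁ k) (suc k) x) (transposed (inject₁ k) (suc k) y) y′<x′
... | inj₁ (refl , y≤c) = refl , toℕ-injective (ℕ.≤-antisym y≤c
        (≡.subst (λ l → suc l ≤ toℕ y) (toℕ-inject₁ k) x<y))
... | inj₂ (refl , b≤x) = toℕ-injective (ℕ.≤-antisym
        (≡.subst (toℕ x ≤_) (≡.sym (toℕ-inject₁ k)) (ℕ.s≤s⁻¹ x<y)) b≤x) , refl

-- The letter to delete is the one at which the two entries get reversed.
exchange : ∀ (u : Word n) i → ⟦ u ⟧ ⟨$⟩ʳ suc i < ⟦ u ⟧ ⟨$⟩ʳ inject₁ i →
  ∃ λ v → ⟦ v ⟧ ≈ ⟦ u ⟧ · s i × suc (length v) ≡ length u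
exchange []      i desc = contradiction desc (ℕ.<-asym (inject₁<suc i))
exchange (k ∷ u) i desc with <-cmp (⟦ u ⟧ ⟨$⟩ʳ inject₁ i) (⟦ u ⟧ ⟨$⟩ʳ suc i)
... | tri> _ _ desc′ =
  let v , v≈ , len≡ = exchange u i desc′
  in k ∷ v , cong (s k ⟨$⟩ʳ_) ∘ v≈ , cong suc len≡
... | tri≈ _ eq _ = contradiction (⟨$⟩ʳ-injective ⟦ u ⟧ eq) (ℕ.<⇒≢ (inject₁<suc i) ∘ cong toℕ)
... | tri< asc _ _ =
  let wb , wc = s-reverses k asc desc
  in u , ≡.sym ∘ s-conjugate ⟦ u ⟧ wb wc , refl

Minimal : Word n → Set
Minimal u = ∀ v → ⟦ v ⟧ ≈ ⟦ u ⟧ → length u ≤ length v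

-- Induction from the right end: the last letter of a minimal word acts at an ascent, since at a
-- descent `exchange` would give a word two letters shorter.
Minimal⇒RunningMax : ∀ {u : Word n} → Reverse u → Minimal u → RunningMax ⟦ u ⟧ (eval u)
Minimal⇒RunningMax [] _ = record { upper = id ; attained = λ j → j , ℕ.≤-refl , refl }
Minimal⇒RunningMax (u ∶ r ∶ʳ i) min with <-cmp (⟦ u ⟧ ⟨$⟩ʳ inject₁ i) (⟦ u ⟧ ⟨$⟩ʳ suc i)
... | tri< asc _ _ =
  RunningMax-resp-≈ (≡.sym ∘ ⟦⟧-++ u [ i ]) $
  RunningMax-cong (≡.sym ∘ eval-++ u [ i ]) $
  RunningMax-ascent i asc (Minimal⇒RunningMax r init-minimal)
  where
  init-minimal : Minimal u
  init-minimal v v≈u = ℕ.s≤s⁻¹ (≡.subst₂ _≤_ (length-∷ʳ u i) (length-∷ʳ v i) (min (v ∷ʳ i) λ j →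
    ≡.trans (⟦⟧-++ v [ i ] j) (≡.trans (v≈u _) (≡.sym (⟦⟧-++ u [ i ] j)))))
... | tri≈ _ eq _ = contradiction (⟨$⟩ʳ-injective ⟦ u ⟧ eq) (ℕ.<⇒≢ (inject₁<suc i) ∘ cong toℕ)
... | tri> _ _ desc =
  let v , v≈ , len≡ = exchange u i desc
      u∷ʳi≤v = min v (λ j → ≡.trans (v≈ j) (≡.sym (⟦⟧-++ u [ i ] j)))
  in contradiction
       (ℕ.≤-trans (ℕ.≤-reflexive (≡.trans (cong suc len≡) (≡.sym (length-∷ʳ u i)))) u∷ʳi≤v)
       (ℕ.<⇒≱ (ℕ.m<n⇒m<1+n (ℕ.n<1+n _)))

open IsReducedWordFor

reduced⇒RunningMax : ∀ {w : Permutation′ (suc n)} {u} → IsReducedWordFor w u → RunningMax w (eval u)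
reduced⇒RunningMax {u = u} red = RunningMax-resp-≈ (represents red) $
  Minimal⇒RunningMax (reverseView u) λ v v≈u → minimal red v λ j → ≡.trans (v≈u j) (represents red j)

-- A competing word for `w · s i` has a descent at `i`, so `exchange` makes it a word for `w` that
-- is one letter shorter, yet not shorter than `u`.
reduced-∷ʳ : ∀ {w : Permutation′ (suc n)} {u} i → w ⟨$⟩ʳ inject₁ i < w ⟨$⟩ʳ suc i →
  IsReducedWordFor w u → IsReducedWordFor (w · s i) (u ∷ʳ i)
reduced-∷ʳ {w = w} {u} i asc red .represents j =
  ≡.trans (⟦⟧-++ u [ i ] j) (represents red _)
reduced-∷ʳ {w = w} {u} i asc red .minimal v v≈ws =
  let v′ , v′≈ , len≡ = exchange v i desc
      u≤v′ = minimal red v′ λ j → ≡.trans (v′≈ j) (≡.trans (v≈ws _)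
               (cong (w ⟨$⟩ʳ_) (transpose-involutive (inject₁ i) (suc i) j)))
  in ≡.subst₂ _≤_ (≡.sym (length-∷ʳ u i)) len≡ (s≤s u≤v′)
  where
  desc : ⟦ v ⟧ ⟨$⟩ʳ suc i < ⟦ v ⟧ ⟨$⟩ʳ inject₁ i
  desc = ≡.subst₂ _<_
    (≡.sym (≡.trans (v≈ws (suc i)) (cong (w ⟨$⟩ʳ_) (transpose-right (inject₁ i) (suc i)))))
    (≡.sym (≡.trans (v≈ws (inject₁ i)) (cong (w ⟨$⟩ʳ_) (transpose-left (inject₁ i) (suc i)))))
    asc

-- Coxeter length

∈-remove : ∀ {y : A} {ys} → y ∈ ys → ∃ λ zs →
  length ys ≡ suc (length zs) × ∀ {z} → z ≢ y → z ∈ ys → z ∈ zs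
∈-remove {ys = _ ∷ ys} (here refl) = ys , refl , λ where
  z≢y (here z≡y)  → contradiction z≡y z≢y
  z≢y (there z∈) → z∈
∈-remove {ys = x ∷ ys} (there y∈) =
  let zs , len≡ , keep = ∈-remove y∈
  in x ∷ zs , cong suc len≡ , λ where
    z≢y (here z≡x)  → here z≡x
    z≢y (there z∈) → there (keep z≢y z∈)

-- Injectivity is asked on members only: the map in `len-transpose` sends both (`b` , `c`) and (`c`
-- , `b`) to (`b` , `c`).
injection⇒length≤ : ∀ {xs : List A} {ys : List B} (f : A → B) → Unique xs →
  (∀ {x} → x ∈ xs → f x ∈ ys) →
  (∀ {x y} → x ∈ xs → y ∈ xs → f x ≡ f y → x ≡ y) →
  length xs ≤ length ys
injection⇒length≤ {xs = []}     f _          into inj = z≤n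
injection⇒length≤ {xs = x ∷ xs} f (x∉ ∷ uniq) into inj =
  let zs , len≡ , keep = ∈-remove (into (here refl))
  in ≡.subst (suc (length xs) ≤_) (≡.sym len≡) (s≤s (injection⇒length≤ f uniq
       (λ y∈ → keep (λ eq → All.lookup x∉ y∈ (≡.sym (inj (there y∈) (here refl) eq))) (into (there y∈)))
       (λ y∈ z∈ → inj (there y∈) (there z∈))))

IsInversion : Permutation′ N → Fin N × Fin N → Set
IsInversion w (i , j) = i < j × w ⟨$⟩ʳ j < w ⟨$⟩ʳ i

isInversion? : ∀ (w : Permutation′ N) p → Dec (IsInversion w p)
isInversion? w (i , j) = i <? j ×-dec (w ⟨$⟩ʳ j) <? (w ⟨$⟩ʳ i)

pairs : ∀ N → List (Fin N × Fin N)
pairs N = cartesianProduct (allFin N) (allFin N)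

inversions : Permutation′ N → List (Fin N × Fin N)
inversions {N} w = filter (isInversion? w) (pairs N)

∈-inversions⁺ : ∀ (w : Permutation′ N) {p} → IsInversion w p → p ∈ inversions w
∈-inversions⁺ w = ∈-filter⁺ (isInversion? w) (∈-cartesianProduct⁺ (∈-allFin _) (∈-allFin _))

∈-inversions⁻ : ∀ (w : Permutation′ N) {p} → p ∈ inversions w → IsInversion w p
∈-inversions⁻ w p∈ = proj₂ (∈-filter⁻ (isInversion? w) {xs = pairs _} p∈)

inversions-unique : (w : Permutation′ N) → Unique (inversions w)
inversions-unique w =
  Unique.filter⁺ (isInversion? w) (Unique.cartesianProduct⁺ (Unique.allFin⁺ _) (Unique.allFin⁺ _))

len-cong : ∀ {w v : Permutation′ N} → w ≈ v → len w ≡ len v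
len-cong {N} {w} {v} w≈v = cong length (filter-≐ (isInversion? w) (isInversion? v)
  ( (λ {(i , j)} (i<j , inv) → i<j , ≡.subst₂ _<_ (w≈v j) (w≈v i) inv)
  , (λ {(i , j)} (i<j , inv) → i<j , ≡.subst₂ _<_ (≡.sym (w≈v j)) (≡.sym (w≈v i)) inv))
  (pairs N))

len≤pairs : (w : Permutation′ N) → len w ≤ length (pairs N)
len≤pairs w = length-filter (isInversion? w) (pairs _)

-- With τ = (b c), an inversion (i , j) of w τ gives the inversion (τ i , τ j)
-- of w if τ keeps i and j in order, and is itself an inversion of w otherwise;
-- (b , c) is missed.
len-transpose : ∀ (w : Permutation′ N) {b c} → b < c → w ⟨$⟩ʳ c < w ⟨$⟩ʳ b →
  len (w · transpose b c) ℕ.< len w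
len-transpose {N} w {b} {c} b<c wc<wb =
  let zs , len≡ , keep = ∈-remove (∈-inversions⁺ w (b<c , wc<wb))
  in ≡.subst (suc (len (w · transpose b c)) ≤_) (≡.sym len≡) (s≤s (injection⇒length≤ f
       (inversions-unique v)
       (λ p∈ → let inv = ∈-inversions⁻ v p∈ in keep (missed inv) (∈-inversions⁺ w (into inv)))
       (λ p∈ q∈ → f-injective (∈-inversions⁻ v p∈) (∈-inversions⁻ v q∈))))
  where
  v = w · transpose b c

  τ : Fin N → Fin N
  τ = transpose b c ⟨$⟩ʳ_

  ττ : ∀ k → τ (τ k) ≡ k
  ττ = transpose-involutive b c

  f : Fin N × Fin N → Fin N × Fin N
  f (i , j) with τ i <? τ j
  ... | yes _ = τ i , τ j
  ... | no  _ = i , j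

  -- With one position unmoved, its entry lies below `w(c)` or above `w(b)`, and `w(c) < w(b)`
  -- carries the comparison over to the other end.
  reversed : ∀ {i i′ j j′} → Transposed b c i i′ → Transposed b c j j′ →
    i < j → ¬ i′ < j′ → w ⟨$⟩ʳ j′ < w ⟨$⟩ʳ i′ → w ⟨$⟩ʳ j < w ⟨$⟩ʳ i
  reversed left left i<j _ _ = contradiction i<j (ℕ.<-irrefl refl)
  reversed left right _ _ inv = contradiction wc<wb (ℕ.<-asym inv)
  reversed left (fixed _ _) _ _ inv = ℕ.<-trans inv wc<wb
  reversed right left i<j _ _ = contradiction b<c (ℕ.<-asym i<j)
  reversed right right i<j _ _ = contradiction i<j (ℕ.<-irrefl refl)
  reversed right (fixed _ _) c<j b≮j _ = contradiction (ℕ.<-trans b<c c<j) b≮j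
  reversed (fixed _ _) left i<b i≮c _ = contradiction (ℕ.<-trans i<b b<c) i≮c
  reversed (fixed _ _) right _ _ inv = ℕ.<-trans wc<wb inv
  reversed (fixed _ _) (fixed _ _) i<j i≮j _ = contradiction i<j i≮j

  into : ∀ {p} → IsInversion v p → IsInversion w (f p)
  into {i , j} (i<j , inv) with τ i <? τ j
  ... | yes τi<τj = τi<τj , inv
  ... | no  τi≮τj = i<j , reversed (transposed b c i) (transposed b c j) i<j τi≮τj inv

  -- If moved, the pair would be (`c` , `b`), which is out of order; if kept, it is (`b` , `c`),
  -- where `v` has no inversion.
  missed : ∀ {p} → IsInversion v p → f p ≢ (b , c)
  missed {i , j} (i<j , inv) eq with τ i <? τ j
  missed {i , j} (i<j , inv) eq | yes _ =
    contradiction b<c (ℕ.<-asym (≡.subst₂ _<_ i≡c j≡b i<j))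
    where
    i≡c : i ≡ c
    i≡c = ≡.trans (≡.sym (ττ i)) (≡.trans (cong (τ ∘ proj₁) eq) (transpose-left b c))
    j≡b : j ≡ b
    j≡b = ≡.trans (≡.sym (ττ j)) (≡.trans (cong (τ ∘ proj₂) eq) (transpose-right b c))
  missed (i<j , inv) refl | no _ = contradiction wc<wb (ℕ.<-asym
    (≡.subst₂ _<_ (cong (w ⟨$⟩ʳ_) (transpose-right b c)) (cong (w ⟨$⟩ʳ_) (transpose-left b c)) inv))

  -- If a moved pair and a kept pair had one image, `τ` would take the kept pair to (`i` , `j`),
  -- which is in order, so it would have been moved too.
  mixed : ∀ {i j k l} → i < j → ¬ τ k < τ l → τ i ≡ k → τ j ≡ l → ⊥
  mixed i<j τk≮τl refl refl = τk≮τl (≡.subst₂ _<_ (≡.sym (ττ _)) (≡.sym (ττ _)) i<j)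

  f-injective : ∀ {p q} → IsInversion v p → IsInversion v q → f p ≡ f q → p ≡ q
  f-injective {i , j} {k , l} (i<j , _) (k<l , _) eq with τ i <? τ j | τ k <? τ l
  ... | yes _ | yes _ = ≡.cong₂ _,_
    (⟨$⟩ʳ-injective (transpose b c) (cong proj₁ eq)) (⟨$⟩ʳ-injective (transpose b c) (cong proj₂ eq))
  ... | yes _ | no τk≮τl = ⊥-elim (mixed i<j τk≮τl (cong proj₁ eq) (cong proj₂ eq))
  ... | no τi≮τj | yes _ = ⊥-elim (mixed k<l τi≮τj (≡.sym (cong proj₁ eq)) (≡.sym (cong proj₂ eq)))
  ... | no _ | no _ = eq

len-transpose-ascent : ∀ (w : Permutation′ N) {b c} → b < c → w ⟨$⟩ʳ b < w ⟨$⟩ʳ c →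
  len w ℕ.< len (w · transpose b c)
len-transpose-ascent w {b} {c} b<c wb<wc = ≡.subst (ℕ._< len v)
  (len-cong {w = v · transpose b c} {w} λ k → cong (w ⟨$⟩ʳ_) (transpose-involutive b c k))
  (len-transpose v b<c (≡.subst₂ _<_
    (cong (w ⟨$⟩ʳ_) (≡.sym (transpose-right b c))) (cong (w ⟨$⟩ʳ_) (≡.sym (transpose-left b c))) wb<wc))
  where v = w · transpose b c

-- Existence of reduced words

no-descent⇒id : ∀ (w : Permutation′ (suc n)) →
  ¬ (∃ λ i → w ⟨$⟩ʳ suc i < w ⟨$⟩ʳ inject₁ i) → ∀ j → w ⟨$⟩ʳ j ≡ j
no-descent⇒id w none j = fixes j (Fin.<-wellFounded j)
  where
  monotone : ∀ {j k} → j Fin.≤ k → w ⟨$⟩ʳ j Fin.≤ w ⟨$⟩ʳ k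
  monotone {j} {k} j≤k = Fin.<-weakInduction-startingFrom (λ k → w ⟨$⟩ʳ j Fin.≤ w ⟨$⟩ʳ k)
    ℕ.≤-refl (λ i le → ℕ.≤-trans le (ℕ.≮⇒≥ (none ∘ (i ,_)))) j≤k

  -- Smaller points are fixed by induction, so neither `w(j)` nor the preimage of `j` can be smaller
  -- than `j`; if `w(j)` exceeds `j`, a larger preimage contradicts monotonicity.
  fixes : ∀ j → Acc _<_ j → w ⟨$⟩ʳ j ≡ j
  fixes j (acc rs) with <-cmp (w ⟨$⟩ʳ j) j | <-cmp (w ⟨$⟩ˡ j) j
  ... | tri≈ _ eq _ | _ = eq
  ... | tri< wj<j _ _ | _ = ⟨$⟩ʳ-injective w (fixes (w ⟨$⟩ʳ j) (rs wj<j))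
  ... | tri> _ _ j<wj | tri< k<j _ _ =
    contradiction (≡.trans (≡.sym (fixes (w ⟨$⟩ˡ j) (rs k<j))) (Perm.inverseʳ w)) (ℕ.<⇒≢ k<j ∘ cong toℕ)
  ... | tri> _ _ j<wj | tri≈ _ eq _ = ≡.trans (cong (w ⟨$⟩ʳ_) (≡.sym eq)) (Perm.inverseʳ w)
  ... | tri> _ _ j<wj | tri> _ _ j<k = contradiction
    (≡.subst ((w ⟨$⟩ʳ j) Fin.≤_) (Perm.inverseʳ w) (monotone (ℕ.<⇒≤ j<k))) (ℕ.<⇒≱ j<wj)

-- Sorting by adjacent swaps: each swap at a descent lowers `len`, and undoing it is a step at an
-- ascent, where `reduced-∷ʳ` applies.
reducedWord : ∀ (w : Permutation′ (suc n)) → ∃ (IsReducedWordFor w)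
reducedWord w = go w (<-wellFounded (len w))
  where
  go : ∀ (w : Permutation′ (suc n)) → Acc ℕ._<_ (len w) → ∃ (IsReducedWordFor w)
  go w (acc rs) with any? (λ i → (w ⟨$⟩ʳ suc i) <? (w ⟨$⟩ʳ inject₁ i))
  ... | no none = [] , record
    { represents = λ j → ≡.sym (no-descent⇒id w none j) ; minimal = λ _ _ → z≤n }
  ... | yes (i , desc) =
    let u , red = go (w · s i) (rs (len-transpose w (inject₁<suc i) desc))
        red′ = reduced-∷ʳ {w = w · s i} i (≡.subst₂ _<_
          (cong (w ⟨$⟩ʳ_) (≡.sym (transpose-left (inject₁ i) (suc i))))
          (cong (w ⟨$⟩ʳ_) (≡.sym (transpose-right (inject₁ i) (suc i)))) desc) red
        back = λ j → cong (w ⟨$⟩ʳ_) (transpose-involutive (inject₁ i) (suc i) j)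
    in u ∷ʳ i , record
      { represents = λ j → ≡.trans (represents red′ j) (back j)
      ; minimal    = λ v v≈w → minimal red′ v λ j → ≡.trans (v≈w j) (≡.sym (back j)) }

-- Membership in `G m` through running maxima

G⇒RunningMax : ∀ {m} {w : Permutation′ (suc n)} → G m w → RunningMax w (eval (Ψ m))
G⇒RunningMax {m = m} (u , red , u≈m) =
  -- As `Ψ` is an involution, `Ψ u ≈ m` in `M` becomes `u ≋ Ψ m`.
  RunningMax-cong (eval-cong (≡.subst (_≋ Ψ m) (Ψ-involutive u) (M⇒≋ u≈m))) (reduced⇒RunningMax red)

RunningMax⇒G : ∀ {m} {w : Permutation′ (suc n)} → RunningMax w (eval (Ψ m)) → G m w
RunningMax⇒G {n} {m} {w} F =
  let u , red = reducedWord w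
      -- The reduced word and `Ψ m` both act as the running maximum of `w`, and the action is
      -- faithful.
      u≋Ψm = eval-injective (RunningMax-unique (reduced⇒RunningMax red) F)
  in u , red , ≡.subst (M._≈_ n (Ψ u)) (Ψ-involutive m) (≋⇒M u≋Ψm)

-- Patterns of length three

-- One implication suffices: by trichotomy and injectivity of `σ`, the order of the entries of `w`
-- determines that of `σ`.
contains : ∀ {σ : Permutation′ 3} {w : Permutation′ N} {a b c} → a < b → b < c →
  (let position = lookup (a ∷ b ∷ c ∷ [])) →
  (∀ i j → σ ⟨$⟩ʳ i < σ ⟨$⟩ʳ j → w ⟨$⟩ʳ position i < w ⟨$⟩ʳ position j) →
  Contains σ w
contains {σ = σ} {w} {a} {b} {c} a<b b<c forward = record
  { position   = lookup (a ∷ b ∷ c ∷ [])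
  ; increasing = λ {i} {j} → incr i j
  ; sameOrder  = λ i j → mk⇔ (backward i j) (forward i j)
  }
  where
  incr : ∀ i j → i < j → lookup (a ∷ b ∷ c ∷ []) i < lookup (a ∷ b ∷ c ∷ []) j
  incr 0F 1F _ = a<b
  incr 0F 2F _ = ℕ.<-trans a<b b<c
  incr 1F 2F _ = b<c
  incr 1F 1F (s≤s ())
  incr 2F 1F (s≤s ())
  incr 2F 2F (s≤s (s≤s ()))

  backward : ∀ i j → w ⟨$⟩ʳ lookup (a ∷ b ∷ c ∷ []) i < w ⟨$⟩ʳ lookup (a ∷ b ∷ c ∷ []) j →
    σ ⟨$⟩ʳ i < σ ⟨$⟩ʳ j
  backward i j w< with <-cmp (σ ⟨$⟩ʳ i) (σ ⟨$⟩ʳ j)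
  ... | tri< σ< _ _ = σ<
  ... | tri≈ _ σ≡ _ with refl ← ⟨$⟩ʳ-injective σ σ≡ = contradiction w< (ℕ.<-irrefl refl)
  ... | tri> _ _ σ> = contradiction (forward j i σ>) (ℕ.<-asym w<)

-- A finite search over three positions; the reductions below branch on its result.
contains? : ∀ (σ : Permutation′ 3) (w : Permutation′ N) → Dec (Contains σ w)
contains? σ w = map′ (λ (a , b , c , a<b , b<c , forward) → contains a<b b<c forward) triple
  (any? λ a → any? λ b → any? λ c → a <? b ×-dec b <? c ×-dec
    all? λ i → all? λ j → (σ ⟨$⟩ʳ i) <? (σ ⟨$⟩ʳ j) →-dec
      (w ⟨$⟩ʳ lookup (a ∷ b ∷ c ∷ []) i) <? (w ⟨$⟩ʳ lookup (a ∷ b ∷ c ∷ []) j))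
  where
  triple : Contains σ w → ∃ λ a → ∃ λ b → ∃ λ c → a < b × b < c × ∀ i j → σ ⟨$⟩ʳ i < σ ⟨$⟩ʳ j →
    w ⟨$⟩ʳ lookup (a ∷ b ∷ c ∷ []) i < w ⟨$⟩ʳ lookup (a ∷ b ∷ c ∷ []) j
  triple C = position 0F , position 1F , position 2F ,
    increasing (s≤s z≤n) , increasing (s≤s (s≤s z≤n)) , λ i j σ< →
      -- The vector of the three positions is `tabulate position` by computation.
      ≡.subst₂ (λ x y → w ⟨$⟩ʳ x < w ⟨$⟩ʳ y) (≡.sym (lookup∘tabulate position i))
        (≡.sym (lookup∘tabulate position j)) (Equivalence.from (sameOrder i j) σ<)
    where open Contains C

contains-321 : ∀ {w : Permutation′ N} {a b c} → a < b → b < c →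
  w ⟨$⟩ʳ c < w ⟨$⟩ʳ b → w ⟨$⟩ʳ b < w ⟨$⟩ʳ a → Contains [321] w
contains-321 a<b b<c wc<wb wb<wa = contains a<b b<c λ where
  1F 0F _ → wb<wa
  2F 0F _ → ℕ.<-trans wc<wb wb<wa
  2F 1F _ → wc<wb
  0F 2F ()
  1F 2F ()
  2F 2F ()
  0F 0F (s≤s (s≤s ()))
  0F 1F (s≤s ())
  1F 1F (s≤s ())

contains-312 : ∀ {w : Permutation′ N} {a b c} → a < b → b < c →
  w ⟨$⟩ʳ b < w ⟨$⟩ʳ c → w ⟨$⟩ʳ c < w ⟨$⟩ʳ a → Contains [312] w
contains-312 a<b b<c wb<wc wc<wa = contains a<b b<c λ where
  1F 0F _ → ℕ.<-trans wb<wc wc<wa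
  1F 2F _ → wb<wc
  2F 0F _ → wc<wa
  0F 1F ()
  1F 1F ()
  2F 1F ()
  0F 0F (s≤s (s≤s ()))
  0F 2F (s≤s ())
  2F 2F (s≤s ())

-- Eliminating pattern occurrences

remove-321 : ∀ {w : Permutation′ N} {f} → RunningMax w f → Contains [321] w →
  ∃ λ v → RunningMax v f × len v ℕ.< len w
remove-321 {w = w} F C =
  w · transpose b c , RunningMax-transpose a<b b<c wb<wa (ℕ.<-trans wc<wb wb<wa) F ,
  len-transpose w b<c wc<wb
  where
  open Contains C
  b = position 1F
  c = position 2F
  a<b = increasing {0F} {1F} (s≤s z≤n)
  b<c = increasing {1F} {2F} (s≤s (s≤s z≤n))
  wb<wa = Equivalence.from (sameOrder 1F 0F) (s≤s (s≤s z≤n))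
  wc<wb = Equivalence.from (sameOrder 2F 1F) (s≤s z≤n)

remove-312 : ∀ {w : Permutation′ N} {f} → RunningMax w f → Contains [312] w →
  ∃ λ v → RunningMax v f × len w ℕ.< len v
remove-312 {w = w} F C =
  w · transpose b c , RunningMax-transpose a<b b<c (ℕ.<-trans wb<wc wc<wa) wc<wa F ,
  len-transpose-ascent w b<c wb<wc
  where
  open Contains C
  b = position 1F
  c = position 2F
  a<b = increasing {0F} {1F} (s≤s z≤n)
  b<c = increasing {1F} {2F} (s≤s (s≤s z≤n))
  wb<wc = Equivalence.from (sameOrder 1F 2F) (s≤s z≤n)
  wc<wa = Equivalence.from (sameOrder 2F 0F) (s≤s (s≤s z≤n))

reduce-321 : ∀ {w : Permutation′ N} {f} → RunningMax w f →
  ∃ λ v → RunningMax v f × Avoids [321] v × len v ≤ len w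
reduce-321 F = go F (<-wellFounded _)
  where
  go : ∀ {w : Permutation′ N} {f} → RunningMax w f → Acc ℕ._<_ (len w) →
    ∃ λ v → RunningMax v f × Avoids [321] v × len v ≤ len w
  go {w = w} F (acc rs) with contains? [321] w
  ... | no avoids = w , F , avoids , ℕ.≤-refl
  ... | yes C =
    let x , X , x<w = remove-321 F C
        v , V , avoids , v≤x = go X (rs x<w)
    in v , V , avoids , ℕ.≤-trans v≤x (ℕ.<⇒≤ x<w)

reduce-312 : ∀ {w : Permutation′ N} {f} → RunningMax w f →
  ∃ λ v → RunningMax v f × Avoids [312] v × len w ≤ len v
reduce-312 F = go F (<-wellFounded _)
  where
  -- The length grows, so termination rests on its distance to the number of all pairs of positions.
  go : ∀ {w : Permutation′ N} {f} → RunningMax w f → Acc ℕ._<_ (length (pairs N) ∸ len w) →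
    ∃ λ v → RunningMax v f × Avoids [312] v × len w ≤ len v
  go {w = w} F (acc rs) with contains? [312] w
  ... | no avoids = w , F , avoids , ℕ.≤-refl
  ... | yes C =
    let x , X , w<x = remove-312 F C
        v , V , avoids , x≤v = go X (rs (ℕ.∸-monoʳ-< w<x (len≤pairs x)))
    in v , V , avoids , ℕ.≤-trans (ℕ.<⇒≤ w<x) x≤v

-- Since u(j) < v(j) ≤ f(j), the value f(j) = u(a) is attained at some a < j,
-- where u and v agree; this a is the 3 of both patterns, and the remaining
-- entry is where the value v(j) occurs in u, respectively u(j) in v.
disagreement : ∀ {u v : Permutation′ N} {f j} → RunningMax u f → RunningMax v f →
  (∀ {k} → k < j → u ⟨$⟩ʳ k ≡ v ⟨$⟩ʳ k) → u ⟨$⟩ʳ j < v ⟨$⟩ʳ j →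
  Contains [312] u × Contains [321] v
disagreement {N} {u} {v} {f} {j} U V agree uj<vj = in-u , in-v
  where
  -- If the value `v(j)` occurred in `u` before `j`, agreement would make `v` take it twice.
  later : ∀ {u v : Permutation′ N} → (∀ {k} → k < j → u ⟨$⟩ʳ k ≡ v ⟨$⟩ʳ k) →
    u ⟨$⟩ʳ j ≢ v ⟨$⟩ʳ j → j < u ⟨$⟩ˡ (v ⟨$⟩ʳ j)
  later {u} {v} agree uj≢vj with <-cmp (u ⟨$⟩ˡ (v ⟨$⟩ʳ j)) j
  ... | tri< k<j _ _ = contradiction
    (⟨$⟩ʳ-injective v (≡.trans (≡.sym (agree k<j)) (Perm.inverseʳ u))) (ℕ.<⇒≢ k<j ∘ cong toℕ)
  ... | tri≈ _ k≡j _ = contradiction (≡.trans (cong (u ⟨$⟩ʳ_) (≡.sym k≡j)) (Perm.inverseʳ u)) uj≢vj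
  ... | tri> _ _ j<k = j<k

  uj≢vj : u ⟨$⟩ʳ j ≢ v ⟨$⟩ʳ j
  uj≢vj = ℕ.<⇒≢ uj<vj ∘ cong toℕ

  a     = proj₁ (attained U j)
  a≤j   = proj₁ (proj₂ (attained U j))
  ua≡fj = proj₂ (proj₂ (attained U j))

  vj≤ua : v ⟨$⟩ʳ j Fin.≤ u ⟨$⟩ʳ a
  vj≤ua = ≡.subst ((v ⟨$⟩ʳ j) Fin.≤_) (≡.sym ua≡fj) (upper V ℕ.≤-refl)

  a<j : a < j
  a<j = ℕ.≤∧≢⇒< a≤j λ eq → ℕ.<⇒≱ uj<vj
    (≡.subst (λ k → v ⟨$⟩ʳ j Fin.≤ u ⟨$⟩ʳ k) (toℕ-injective eq) vj≤ua)

  vj<va : v ⟨$⟩ʳ j < v ⟨$⟩ʳ a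
  vj<va = ℕ.≤∧≢⇒< (≡.subst ((v ⟨$⟩ʳ j) Fin.≤_) (agree a<j) vj≤ua)
    λ eq → ℕ.<⇒≢ a<j (cong toℕ (≡.sym (⟨$⟩ʳ-injective v (toℕ-injective eq))))

  in-u : Contains [312] u
  in-u = contains-312 a<j (later {u} {v} agree uj≢vj)
    (≡.subst (u ⟨$⟩ʳ j <_) (≡.sym (Perm.inverseʳ u)) uj<vj)
    (≡.subst₂ _<_ (≡.sym (Perm.inverseʳ u)) (≡.sym (agree a<j)) vj<va)

  in-v : Contains [321] v
  in-v = contains-321 a<j (later {v} {u} (≡.sym ∘ agree) (uj≢vj ∘ ≡.sym))
    (≡.subst (_< v ⟨$⟩ʳ j) (≡.sym (Perm.inverseʳ v)) uj<vj) vj<va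

-- The hypotheses exclude exactly the two outcomes of `disagreement`, so they cover two 321-avoiders
-- as well as two 312-avoiders.
avoiders-agree : ∀ {u v : Permutation′ N} {f} → RunningMax u f → RunningMax v f →
  ¬ (Contains [312] u × Contains [321] v) → ¬ (Contains [312] v × Contains [321] u) → u ≈ v
avoiders-agree {N} {u} {v} U V not-uv not-vu j = go j (Fin.<-wellFounded j)
  where
  go : ∀ j → Acc _<_ j → u ⟨$⟩ʳ j ≡ v ⟨$⟩ʳ j
  go j (acc rs) with <-cmp (u ⟨$⟩ʳ j) (v ⟨$⟩ʳ j)
  ... | tri< u<v _ _ = contradiction (disagreement U V (λ k<j → go _ (rs k<j)) u<v) not-uv
  ... | tri≈ _ eq _  = eq
  ... | tri> _ _ v<u = contradiction (disagreement V U (λ k<j → ≡.sym (go _ (rs k<j))) v<u) not-vu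

-- Extremal elements of `G m`

module _ (P : ∀ {N} → Permutation′ N → Set) (_⊑_ : ℕ → ℕ → Set)
  (reduce : ∀ {N} {w : Permutation′ N} {f} → RunningMax w f →
    ∃ λ v → RunningMax v f × P v × len v ⊑ len w)
  (unique : ∀ {N} {u v : Permutation′ N} {f} → RunningMax u f → RunningMax v f →
    P u → P v → u ≈ v)
  where

  -- By uniqueness every `v` in `G m` reduces to the same element `w`, so the length comparison
  -- along the reduction is one with `w`.
  extremal : ∀ {n} (m : M.Carrier n) → ∃ (G m) →
    Σ (∃! _≈_ λ (w : Permutation′ (suc n)) → G m w × P w) λ (w , _) →
    ∀ v → G m v → len w ⊑ len v
  extremal m (v₀ , g₀) =
    let w , W , Pw , _ = reduce (G⇒RunningMax {w = v₀} g₀)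
    in (w , (RunningMax⇒G {m = m} {w} W , Pw) , λ {y} (gy , Py) → unique W (G⇒RunningMax {w = y} gy) Pw Py) ,
       λ v gv → let x , X , Px , x⊑v = reduce (G⇒RunningMax {w = v} gv)
                in ≡.subst (_⊑ len v) (len-cong {w = x} {w} (unique X W Px Pw)) x⊑v

mainTheorem2 : ∀ (n : ℕ) (m : M.Carrier n) → ∃ (G m) →
    (Σ (∃! _≈_ λ (w : Permutation′ (suc n)) → G m w × Avoids [321] w)
    λ (w , _) → ∀ v → G m v → len w ≤ len v)
    ×
    (Σ (∃! _≈_ λ (w : Permutation′ (suc n)) → G m w × Avoids [312] w)
    λ (w , _) → ∀ v → G m v → len v ≤ len w)
mainTheorem2 n m nonempty =
  extremal (Avoids [321]) _≤_ reduce-321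
    (λ U V u∌ v∌ → avoiders-agree U V (v∌ ∘ proj₂) (u∌ ∘ proj₂)) m nonempty ,
  extremal (Avoids [312]) (λ k l → l ≤ k) reduce-312
    (λ U V u∌ v∌ → avoiders-agree U V (u∌ ∘ proj₁) (v∌ ∘ proj₁)) m nonempty
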